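{- Let $u\in V$ and let $t\le\lceil\frac{n-\kappa}{2}\rceil$ be a positive integer. If there exists a $\kappa$-cut $U$ with $u\notin U$ and $|\mathrm{Side}_U(u)|\le t$, then there is a unique such $\kappa$-cut, denoted $\mathrm{Small}_t(u)$, with $u\notin\mathrm{Small}_t(u)$, $|\mathrm{Side}_{\mathrm{Small}_t(u)}(u)|\le t$, and $\mathrm{Side}_{\mathrm{Small}_t(u)}(u)\subseteq\mathrm{Side}_U(u)$ for every $\kappa$-cut $U$ with $u\notin U$ and $|\mathrm{Side}_U(u)|\le t$.
   Context: $G=(V,E)$ is a finite, simple, connected, undirected, non-complete graph with $n=|V|$; $\kappa$ is its vertex connectivity, assumed $\kappa<n/4$. A cut is a set $U\subset V$ whose removal disconnects $G$; a $\kappa$-cut is a cut of size $\kappa$; a side of $U$ is a connected component of the subgraph induced on $V\setminus U$; for $x\notin U$, $\mathrm{Side}_U(x)$ is the side of $U$ containing $x$. -}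

module Defs where

open import Data.Fin using (Fin)
open import Data.Fin.Properties using (any?)
open import Data.Fin.Subset using (Subset; inside; _∈_; _∉_; _∪_; ⁅_⁆; ∣_∣)
open import Data.Fin.Subset.Properties using (_∈?_; ∣p∣≤n; p⊂q⇒∣p∣<∣q∣; p⊆p∪q; q⊆p∪q; x∈p∪q⁻; x∈⁅x⁆; x∈⁅y⁆⇒x≡y)
open import Data.Nat using (ℕ; zero; suc; _+_; _≤_)
open import Data.Nat.Properties using (≤-trans; ≤-reflexive; +-monoʳ-≤; +-suc; m≤m+n; 1+n≰n)
open import Data.Product using (∃; ∃₂; _×_; _,_)
open import Data.Sum using ([_,_]′)
open import Data.Vec using (tabulate)
open import Data.Vec.Properties using (lookup∘tabulate; lookup⇒[]=; []=⇒lookup)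
open import Function using (_∘_; _⇔_; mk⇔; Equivalence)
open import Level using (0ℓ)
open import Relation.Binary using (Rel; Decidable; Symmetric)
open import Relation.Binary.Construct.Closure.ReflexiveTransitive using (Star; ε; _◅_; _◅◅_)
open import Relation.Binary.PropositionalEquality using (_≡_; _≢_; sym; trans; subst)
open import Relation.Nullary using (¬_; Dec; yes; no; does; contradiction)
open import Relation.Nullary.Decidable using (_×-dec_; ¬?; dec-true)

record Graph (n : ℕ) : Set₁ where
  field
    Adj        : Rel (Fin n) 0ℓ
    adj?       : Decidable Adj
    adj-sym    : Symmetric Adj
    adj-irrefl : ∀ {x} → ¬ Adj x x

-- Reachability for a decidable relation on a finite type is decidable: grow a
-- set of vertices reachable from x until no edge leaves it.
module _ {n : ℕ} {R : Rel (Fin n) 0ℓ} (R? : Decidable R) where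

  private
    Closure : Fin n → Set
    Closure x = ∃ λ S → ∀ y → y ∈ S ⇔ Star R x y

    grow : ∀ k x S → n ≤ k + ∣ S ∣ → x ∈ S → (∀ y → y ∈ S → Star R x y) → Closure x
    grow k x S n≤ x∈S sound
      with any? (λ y → any? (λ z → (y ∈? S) ×-dec (¬? (z ∈? S) ×-dec R? y z)))
    ... | no closed = S , λ y → mk⇔ (sound y) (complete x∈S)
      where
      complete : ∀ {y z} → y ∈ S → Star R y z → z ∈ S
      complete y∈S ε = y∈S
      complete {y} y∈S (_◅_ {j = w} r rs) with w ∈? S
      ... | yes w∈S = complete w∈S rs
      ... | no  w∉S = contradiction (y , w , y∈S , w∉S , r) closed
    ... | yes (y , z , y∈S , z∉S , r) = continue k n≤
      where
      S′ : Subset n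
      S′ = S ∪ ⁅ z ⁆
      S<S′ : suc ∣ S ∣ ≤ ∣ S′ ∣
      S<S′ = p⊂q⇒∣p∣<∣q∣ (p⊆p∪q ⁅ z ⁆ , z , q⊆p∪q S ⁅ z ⁆ (x∈⁅x⁆ z) , z∉S)
      sound′ : ∀ w → w ∈ S′ → Star R x w
      sound′ w w∈S′ = [ sound w
                      , (λ w∈z → subst (Star R x) (sym (x∈⁅y⁆⇒x≡y z w∈z)) (sound y y∈S ◅◅ (r ◅ ε)))
                      ]′ (x∈p∪q⁻ S ⁅ z ⁆ w∈S′)
      continue : ∀ k → n ≤ k + ∣ S ∣ → Closure x
      continue zero    n≤S = contradiction (≤-trans S<S′ (≤-trans (∣p∣≤n S′) n≤S)) 1+n≰n
      continue (suc k) n≤S =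
        grow k x S′
          (≤-trans n≤S (≤-trans (≤-reflexive (sym (+-suc k ∣ S ∣))) (+-monoʳ-≤ k S<S′)))
          (p⊆p∪q ⁅ z ⁆ x∈S) sound′

  star? : Decidable (Star R)
  star? x y with grow n x ⁅ x ⁆ (m≤m+n n _) (x∈⁅x⁆ x)
                   (λ y y∈x → subst (Star R x) (sym (x∈⁅y⁆⇒x≡y x y∈x)) ε)
  ... | S , S⇔ with y ∈? S
  ...   | yes y∈S = yes (Equivalence.to (S⇔ y) y∈S)
  ...   | no  y∉S = no (y∉S ∘ Equivalence.from (S⇔ y))

module _ {n : ℕ} (G : Graph n) where
  open Graph G

  Connected : Set
  Connected = ∀ x y → Star Adj x y

  Complete : Set
  Complete = ∀ x y → x ≢ y → Adj x y

  -- The edges of the subgraph induced on V ∖ U.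
  AdjOutside : Subset n → Rel (Fin n) 0ℓ
  AdjOutside U x y = x ∉ U × y ∉ U × Adj x y

  adjOutside? : ∀ U → Decidable (AdjOutside U)
  adjOutside? U x y = ¬? (x ∈? U) ×-dec (¬? (y ∈? U) ×-dec adj? x y)

  -- For x ∉ U, the vertices reachable from x in this sense are all outside U.
  ReachableOutside : Subset n → Rel (Fin n) 0ℓ
  ReachableOutside U = Star (AdjOutside U)

  reachableOutside? : ∀ U → Decidable (ReachableOutside U)
  reachableOutside? U = star? (adjOutside? U)

  IsCut : Subset n → Set
  IsCut U = ∃₂ λ x y → x ∉ U × y ∉ U × ¬ ReachableOutside U x y

  IsCutOfSize : ℕ → Subset n → Set
  IsCutOfSize k U = IsCut U × ∣ U ∣ ≡ k

  IsVertexConnectivity : ℕ → Set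
  IsVertexConnectivity κ = ∃ (IsCutOfSize κ) × (∀ U → IsCut U → κ ≤ ∣ U ∣)

  -- The connected component of x in the subgraph induced on V ∖ U. Only
  -- meaningful for x ∉ U; for x ∈ U it is the junk value ⁅ x ⁆.
  Side : Subset n → Fin n → Subset n
  Side U x = tabulate λ y → does (reachableOutside? U x y)

  ∈Side⇔ : ∀ U x y → y ∈ Side U x ⇔ ReachableOutside U x y
  ∈Side⇔ U x y = mk⇔
    (λ y∈ → does-true (reachableOutside? U x y) (trans (sym lookup≡) ([]=⇒lookup y∈)))
    (λ p → lookup⇒[]= y (Side U x) (trans lookup≡ (dec-true (reachableOutside? U x y) p)))
    where
    lookup≡ = lookup∘tabulate (λ y → does (reachableOutside? U x y)) y
    does-true : ∀ {A : Set} (a? : Dec A) → does a? ≡ inside → A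
    does-true (yes a) _ = a

{-# OPTIONS --safe #-}

-- For a κ-cut U with u ∉ U, minimality of κ forces U to be the boundary of
-- A = Side U u, so a κ-cut is determined by its side at u; this is uniqueness.
-- If U and W are both admissible with sides A and B at u, then
-- ∣∂(A ∩ B)∣ + ∣∂(A ∪ B)∣ ≤ ∣∂A∣ + ∣∂B∣ = 2κ. If ∣∂(A ∩ B)∣ exceeded κ, then
-- ∣∂(A ∪ B)∣ < κ would not be a cut, so A ∪ B ∪ ∂(A ∪ B) would be all of V,
-- which is too large because ∣A∣ , ∣B∣ ≤ ⌈(n − κ)/2⌉ and A ∩ B ≠ ∅. Hence
-- ∂(A ∩ B) is again admissible, with its side at u inside A ∩ B, and an
-- admissible cut whose side at u has least size is the one sought.
module Submission where

open import Defs
open import Data.Bool using (true)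
open import Data.Fin using (Fin)
open import Data.Fin.Properties using (any?)
open import Data.Fin.Subset using (Subset; inside; outside; _∈_; _∉_; _⊆_; _∪_; _∩_; ∣_∣; ⊤)
open import Data.Fin.Subset.Properties using (_∈?_; _⊆?_; ⊆-antisym; ∣⊤∣≡n; ∣⁅x⁆∣≡1; ∣⊥∣≡0; ∣p∣≤n; Empty-unique; anySubset?; p⊆q⇒∣p∣≤∣q∣; p⊂q⇒∣p∣<∣q∣; p∩q⊆p; p∩q⊆q; x∈p∩q⁺; x∈p∩q⁻; p⊆p∪q; q⊆p∪q; x∈p∪q⁺; x∈p∪q⁻; x∈⁅y⁆⇒x≡y)
open import Data.Nat using (ℕ; suc; _+_; _∸_; _*_; _≤_; _<_; ⌈_/2⌉; _≟_; _≤?_)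
open import Data.Nat.Induction using (<-rec)
open import Data.Nat.Properties
open import Data.Nat.Tactic.RingSolver using (solve-∀)
open import Data.Product using (∃; ∃!; _×_; _,_; proj₁; proj₂)
open import Data.Sum using (inj₁; inj₂; [_,_]′)
open import Data.Vec using ([]; _∷_; tabulate)
open import Data.Vec.Properties using (lookup∘tabulate; lookup⇒[]=; []=⇒lookup)
open import Function using (_∘_; _⇔_; mk⇔; Equivalence)
open import Level using (0ℓ)
open import Relation.Binary.Construct.Closure.ReflexiveTransitive using (ε; _◅_; _◅◅_; reverse)
open import Relation.Binary.PropositionalEquality using (_≡_; refl; sym; trans; cong; subst)
open import Relation.Nullary using (¬_; Dec; yes; no; does; contradiction)
open import Relation.Nullary.Decidable using (_×-dec_; ¬?; dec-true; decidable-stable)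
open import Relation.Unary using (Pred; Decidable)

open Equivalence using (to; from)

-- Finite subsets and their cardinalities.

module _ {n : ℕ} where

  comprehension : {P : Pred (Fin n) 0ℓ} → Decidable P → Subset n
  comprehension P? = tabulate (does ∘ P?)

  ∈comprehension⇔ : ∀ {P : Pred (Fin n) 0ℓ} (P? : Decidable P) x → x ∈ comprehension P? ⇔ P x
  ∈comprehension⇔ P? x = mk⇔
    (λ x∈ → does-true (P? x) (trans (sym lookup≡) ([]=⇒lookup x∈)))
    (λ p → lookup⇒[]= x (comprehension P?) (trans lookup≡ (dec-true (P? x) p)))
    where
    lookup≡ = lookup∘tabulate (does ∘ P?) x
    does-true : ∀ {A : Set} (a? : Dec A) → does a? ≡ true → A
    does-true (yes a) _ = a

  p⊆q∧∣q∣≤∣p∣⇒p≡q : ∀ {p q : Subset n} → p ⊆ q → ∣ q ∣ ≤ ∣ p ∣ → p ≡ q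
  p⊆q∧∣q∣≤∣p∣⇒p≡q {p} {q} p⊆q ∣q∣≤∣p∣ = ⊆-antisym p⊆q q⊆p
    where
    q⊆p : q ⊆ p
    q⊆p {x} x∈q with x ∈? p
    ... | yes x∈p = x∈p
    ... | no  x∉p = contradiction (p⊂q⇒∣p∣<∣q∣ (p⊆q , x , x∈q , x∉p)) (≤⇒≯ ∣q∣≤∣p∣)

  x∈p⇒0<∣p∣ : ∀ {x} {p : Subset n} → x ∈ p → 0 < ∣ p ∣
  x∈p⇒0<∣p∣ {x} {p} x∈p = subst (_≤ ∣ p ∣) (∣⁅x⁆∣≡1 x)
    (p⊆q⇒∣p∣≤∣q∣ λ y∈ → subst (_∈ p) (sym (x∈⁅y⁆⇒x≡y x y∈)) x∈p)

∣p∪q∣+∣p∩q∣≡∣p∣+∣q∣ : ∀ {n} (p q : Subset n) → ∣ p ∪ q ∣ + ∣ p ∩ q ∣ ≡ ∣ p ∣ + ∣ q ∣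
∣p∪q∣+∣p∩q∣≡∣p∣+∣q∣ []            []            = refl
∣p∪q∣+∣p∩q∣≡∣p∣+∣q∣ (outside ∷ p) (outside ∷ q) = ∣p∪q∣+∣p∩q∣≡∣p∣+∣q∣ p q
∣p∪q∣+∣p∩q∣≡∣p∣+∣q∣ (outside ∷ p) (inside  ∷ q) =
  trans (cong suc (∣p∪q∣+∣p∩q∣≡∣p∣+∣q∣ p q)) (sym (+-suc ∣ p ∣ ∣ q ∣))
∣p∪q∣+∣p∩q∣≡∣p∣+∣q∣ (inside  ∷ p) (outside ∷ q) = cong suc (∣p∪q∣+∣p∩q∣≡∣p∣+∣q∣ p q)
∣p∪q∣+∣p∩q∣≡∣p∣+∣q∣ (inside  ∷ p) (inside  ∷ q) = cong suc
  (trans (+-suc _ _) (trans (cong suc (∣p∪q∣+∣p∩q∣≡∣p∣+∣q∣ p q)) (sym (+-suc ∣ p ∣ ∣ q ∣))))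

disjoint⇒∣p∪q∣≡∣p∣+∣q∣ : ∀ {n} (p q : Subset n) → (∀ {x} → x ∈ p → x ∉ q) →
  ∣ p ∪ q ∣ ≡ ∣ p ∣ + ∣ q ∣
disjoint⇒∣p∪q∣≡∣p∣+∣q∣ {n} p q disjoint =
  trans (sym (trans (cong (∣ p ∪ q ∣ +_) ∣p∩q∣≡0) (+-identityʳ _))) (∣p∪q∣+∣p∩q∣≡∣p∣+∣q∣ p q)
  where
  ∣p∩q∣≡0 : ∣ p ∩ q ∣ ≡ 0
  ∣p∩q∣≡0 = trans
    (cong ∣_∣ (Empty-unique {p = p ∩ q} λ (_ , x∈) → let x∈p , x∈q = x∈p∩q⁻ p q x∈ in disjoint x∈p x∈q))
    (∣⊥∣≡0 n)

-- By definition `⌈ n /2⌉` is `⌊ suc n /2⌋`, hence at most `⌈ suc n /2⌉`, and these two halves add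
-- up to `suc n`.
⌈n/2⌉+⌈n/2⌉≤1+n : ∀ n → ⌈ n /2⌉ + ⌈ n /2⌉ ≤ suc n
⌈n/2⌉+⌈n/2⌉≤1+n n = begin
  ⌈ n /2⌉ + ⌈ n /2⌉      ≤⟨ +-monoʳ-≤ ⌈ n /2⌉ (⌊n/2⌋≤⌈n/2⌉ (suc n)) ⟩
  ⌈ n /2⌉ + ⌈ suc n /2⌉  ≡⟨ ⌊n/2⌋+⌈n/2⌉≡n (suc n) ⟩
  suc n                  ∎
  where open ≤-Reasoning

-- Vertex boundaries, closed neighbourhoods and submodularity.

module _ {n : ℕ} (G : Graph n) where
  open Graph G

  private
    inBoundary? : ∀ X → Decidable (λ y → y ∉ X × ∃ λ x → x ∈ X × Adj x y)
    inBoundary? X y = ¬? (y ∈? X) ×-dec any? (λ x → (x ∈? X) ×-dec adj? x y)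

  ∂ : Subset n → Subset n
  ∂ X = comprehension (inBoundary? X)

  ∈∂⇔ : ∀ X y → y ∈ ∂ X ⇔ (y ∉ X × ∃ λ x → x ∈ X × Adj x y)
  ∈∂⇔ X = ∈comprehension⇔ (inBoundary? X)

  ∉∂ : ∀ {X x} → x ∈ X → x ∉ ∂ X
  ∉∂ {X} {x} x∈X x∈∂X = proj₁ (to (∈∂⇔ X x) x∈∂X) x∈X

  -- The closed neighbourhood. Unlike `∂` it is monotone, so submodularity is shown for it first and
  -- then carried over to `∂`.
  N[_] : Subset n → Subset n
  N[ X ] = X ∪ ∂ X

  ∣N[_]∣ : ∀ X → ∣ N[ X ] ∣ ≡ ∣ X ∣ + ∣ ∂ X ∣
  ∣N[ X ]∣ = disjoint⇒∣p∪q∣≡∣p∣+∣q∣ X (∂ X) ∉∂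

  adj⇒∈N : ∀ {X x y} → x ∈ X → Adj x y → y ∈ N[ X ]
  adj⇒∈N {X} {x} {y} x∈X xy with y ∈? X
  ... | yes y∈X = x∈p∪q⁺ (inj₁ y∈X)
  ... | no  y∉X = x∈p∪q⁺ (inj₂ (from (∈∂⇔ X y) (y∉X , x , x∈X , xy)))

  N-mono : ∀ {X Y} → X ⊆ Y → N[ X ] ⊆ N[ Y ]
  N-mono {X} X⊆Y {y} y∈ with x∈p∪q⁻ X (∂ X) y∈
  ... | inj₁ y∈X  = x∈p∪q⁺ (inj₁ (X⊆Y y∈X))
  ... | inj₂ y∈∂X with to (∈∂⇔ X y) y∈∂X
  ...   | _ , x , x∈X , xy = adj⇒∈N (X⊆Y x∈X) xy

  N-∪ : ∀ X Y → N[ X ∪ Y ] ⊆ N[ X ] ∪ N[ Y ]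
  N-∪ X Y {y} y∈ with x∈p∪q⁻ (X ∪ Y) (∂ (X ∪ Y)) y∈
  ... | inj₁ y∈X∪Y = [ p⊆p∪q _ ∘ p⊆p∪q _ , q⊆p∪q _ _ ∘ p⊆p∪q _ ]′ (x∈p∪q⁻ X Y y∈X∪Y)
  ... | inj₂ y∈∂   with to (∈∂⇔ (X ∪ Y) y) y∈∂
  ...   | _ , x , x∈X∪Y , xy =
    [ (λ x∈X → p⊆p∪q _ (adj⇒∈N x∈X xy)) , (λ x∈Y → q⊆p∪q _ _ (adj⇒∈N x∈Y xy)) ]′ (x∈p∪q⁻ X Y x∈X∪Y)

  -- Inclusion-exclusion for `N[ X ]` and `N[ Y ]`: their union contains `N[ X ∪ Y ]`, their
  -- intersection contains `N[ X ∩ Y ]`.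
  ∣N∣-submodular : ∀ X Y → ∣ N[ X ∪ Y ] ∣ + ∣ N[ X ∩ Y ] ∣ ≤ ∣ N[ X ] ∣ + ∣ N[ Y ] ∣
  ∣N∣-submodular X Y = begin
    ∣ N[ X ∪ Y ] ∣ + ∣ N[ X ∩ Y ] ∣            ≤⟨ +-mono-≤ (p⊆q⇒∣p∣≤∣q∣ (N-∪ X Y)) (p⊆q⇒∣p∣≤∣q∣ N-∩) ⟩
    ∣ N[ X ] ∪ N[ Y ] ∣ + ∣ N[ X ] ∩ N[ Y ] ∣  ≡⟨ ∣p∪q∣+∣p∩q∣≡∣p∣+∣q∣ N[ X ] N[ Y ] ⟩
    ∣ N[ X ] ∣ + ∣ N[ Y ] ∣                    ∎
    where
    open ≤-Reasoning
    N-∩ : N[ X ∩ Y ] ⊆ N[ X ] ∩ N[ Y ]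
    N-∩ y∈ = x∈p∩q⁺ (N-mono (p∩q⊆p X Y) y∈ , N-mono (p∩q⊆q X Y) y∈)

  -- Since `∂ X` is disjoint from `X`, `∣ ∂ X ∣` is `∣ N[ X ] ∣` minus `∣ X ∣`, and cardinality is
  -- modular, so the subtracted terms cancel.
  ∣∂∣-submodular : ∀ X Y → ∣ ∂ (X ∪ Y) ∣ + ∣ ∂ (X ∩ Y) ∣ ≤ ∣ ∂ X ∣ + ∣ ∂ Y ∣
  ∣∂∣-submodular X Y = +-cancelˡ-≤ (∣ X ∣ + ∣ Y ∣) _ _ (begin
    ∣ X ∣ + ∣ Y ∣ + (∣ ∂ (X ∪ Y) ∣ + ∣ ∂ (X ∩ Y) ∣)
      ≡⟨ cong (_+ (∣ ∂ (X ∪ Y) ∣ + ∣ ∂ (X ∩ Y) ∣)) (∣p∪q∣+∣p∩q∣≡∣p∣+∣q∣ X Y) ⟨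
    ∣ X ∪ Y ∣ + ∣ X ∩ Y ∣ + (∣ ∂ (X ∪ Y) ∣ + ∣ ∂ (X ∩ Y) ∣)
      ≡⟨ +-interchange ∣ X ∪ Y ∣ _ _ _ ⟩
    ∣ X ∪ Y ∣ + ∣ ∂ (X ∪ Y) ∣ + (∣ X ∩ Y ∣ + ∣ ∂ (X ∩ Y) ∣)
      ≡⟨ cong (_+ (∣ X ∩ Y ∣ + ∣ ∂ (X ∩ Y) ∣)) ∣N[ X ∪ Y ]∣ ⟨
    ∣ N[ X ∪ Y ] ∣ + (∣ X ∩ Y ∣ + ∣ ∂ (X ∩ Y) ∣)
      ≡⟨ cong (∣ N[ X ∪ Y ] ∣ +_) ∣N[ X ∩ Y ]∣ ⟨
    ∣ N[ X ∪ Y ] ∣ + ∣ N[ X ∩ Y ] ∣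
      ≤⟨ ∣N∣-submodular X Y ⟩
    ∣ N[ X ] ∣ + ∣ N[ Y ] ∣
      ≡⟨ cong (_+ ∣ N[ Y ] ∣) ∣N[ X ]∣ ⟩
    ∣ X ∣ + ∣ ∂ X ∣ + ∣ N[ Y ] ∣
      ≡⟨ cong (∣ X ∣ + ∣ ∂ X ∣ +_) ∣N[ Y ]∣ ⟩
    ∣ X ∣ + ∣ ∂ X ∣ + (∣ Y ∣ + ∣ ∂ Y ∣)
      ≡⟨ +-interchange ∣ X ∣ _ _ _ ⟩
    ∣ X ∣ + ∣ Y ∣ + (∣ ∂ X ∣ + ∣ ∂ Y ∣) ∎)
    where
    open ≤-Reasoning
    +-interchange : ∀ a b c d → a + b + (c + d) ≡ a + c + (b + d)
    +-interchange = solve-∀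

  -- The first vertex of a walk outside `X` would lie in `∂ X`, which the walk avoids.
  reachableOutside-∂ : ∀ {X x y} → x ∈ X → ReachableOutside G (∂ X) x y → y ∈ X
  reachableOutside-∂ x∈X ε = x∈X
  reachableOutside-∂ {X} x∈X ((_ , z∉∂X , xz) ◅ zs) =
    reachableOutside-∂ ([ (λ z∈X → z∈X) , (λ z∈∂X → contradiction z∈∂X z∉∂X) ]′
      (x∈p∪q⁻ X (∂ X) (adj⇒∈N x∈X xz))) zs

  -- Only an inclusion, because `X` may induce a disconnected subgraph.
  Side-∂ : ∀ {X x} → x ∈ X → Side G (∂ X) x ⊆ X
  Side-∂ {X} {x} x∈X {y} y∈ = reachableOutside-∂ x∈X (to (∈Side⇔ G (∂ X) x y) y∈)

  ∂-isCut : ∀ {X x y} → x ∈ X → y ∉ N[ X ] → IsCut G (∂ X)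
  ∂-isCut {X} {x} {y} x∈X y∉N = x , y , ∉∂ x∈X , y∉N ∘ q⊆p∪q X (∂ X) ,
    λ r → y∉N (p⊆p∪q (∂ X) (reachableOutside-∂ x∈X r))

  -- Boundaries of sides.

  module _ (U : Subset n) {u : Fin n} (u∉U : u ∉ U) where

    u∈Side : u ∈ Side G U u
    u∈Side = from (∈Side⇔ G U u u) ε

    reachableOutside-∉ : ∀ {x y} → x ∉ U → ReachableOutside G U x y → y ∉ U
    reachableOutside-∉ x∉U ε                   = x∉U
    reachableOutside-∉ x∉U ((_ , z∉U , _) ◅ r) = reachableOutside-∉ z∉U r

    -- A neighbour of the side that lay outside `U` would be reachable from `u` by one more edge.
    ∂-Side⊆ : ∂ (Side G U u) ⊆ U
    ∂-Side⊆ {y} y∈ with to (∈∂⇔ (Side G U u) y) y∈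
    ... | y∉Side , x , x∈Side , xy = decidable-stable (y ∈? U) λ y∉U →
      let r = to (∈Side⇔ G U u x) x∈Side in
      y∉Side (from (∈Side⇔ G U u y) (r ◅◅ ((reachableOutside-∉ u∉U r , y∉U , xy) ◅ ε)))

    ∉N-Side : ∀ {v} → v ∉ U → v ∉ Side G U u → v ∉ N[ Side G U u ]
    ∉N-Side v∉U v∉S v∈N = [ v∉S , v∉U ∘ ∂-Side⊆ ]′ (x∈p∪q⁻ _ _ v∈N)

    -- Two separated vertices cannot both be on the side of `u`, as reversing one path would join
    -- them through `u`. The one off the side is also off its boundary, which lies in `U`.
    cut⇒∃∉N-Side : IsCut G U → ∃ λ v → v ∉ N[ Side G U u ]
    cut⇒∃∉N-Side (x , y , x∉U , y∉U , ¬xy) with x ∈? Side G U u | y ∈? Side G U u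
    ... | no x∉S  | _       = x , ∉N-Side x∉U x∉S
    ... | yes _   | no y∉S  = y , ∉N-Side y∉U y∉S
    ... | yes x∈S | yes y∈S = contradiction
      (reverse (λ (a , b , ab) → b , a , adj-sym ab) (to (∈Side⇔ G U u x) x∈S) ◅◅ to (∈Side⇔ G U u y) y∈S)
      ¬xy

  isCut? : ∀ U → Dec (IsCut G U)
  isCut? U = any? λ x → any? λ y → ¬? (x ∈? U) ×-dec (¬? (y ∈? U) ×-dec ¬? (reachableOutside? G U x y))

  -- Minimum cuts and their sides at a fixed vertex.

  module _ {κ : ℕ} (κ-min : ∀ U → IsCut G U → κ ≤ ∣ U ∣) (u : Fin n) where

    -- The boundary of the side is a subset of `U` and itself a cut, so minimality of `κ` leaves no
    -- room for a proper inclusion.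
    ∂-Side≡ : ∀ {U} → IsCutOfSize G κ U → u ∉ U → ∂ (Side G U u) ≡ U
    ∂-Side≡ {U} (cut , ∣U∣≡κ) u∉U = p⊆q∧∣q∣≤∣p∣⇒p≡q (∂-Side⊆ U u∉U)
      (subst (_≤ ∣ ∂ (Side G U u) ∣) (sym ∣U∣≡κ)
        (κ-min _ (∂-isCut (u∈Side U u∉U) (proj₂ (cut⇒∃∉N-Side U u∉U cut)))))

    module _ {t : ℕ} (t≤ : t ≤ ⌈ n ∸ κ /2⌉) where

      Admissible : Subset n → Set
      Admissible U = IsCutOfSize G κ U × u ∉ U × ∣ Side G U u ∣ ≤ t

      admissible? : Decidable Admissible
      admissible? U = (isCut? U ×-dec (∣ U ∣ ≟ κ)) ×-dec (¬? (u ∈? U) ×-dec (∣ Side G U u ∣ ≤? t))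

      ∂-∩-admissible : ∀ {U W} → Admissible U → Admissible W → Admissible (∂ (Side G U u ∩ Side G W u))
      ∂-∩-admissible {U} {W} (cutU@(isCutU , ∣U∣≡κ) , u∉U , A≤t) (cutW@(_ , ∣W∣≡κ) , u∉W , B≤t) =
        (isCut , ≤-antisym (≮⇒≥ κ≮∣∂X∣) (κ-min (∂ X) isCut)) , ∉∂ u∈X ,
        ≤-trans (p⊆q⇒∣p∣≤∣q∣ (p∩q⊆p A B ∘ Side-∂ u∈X)) A≤t
        where
        A B X Y : Subset n
        A = Side G U u
        B = Side G W u
        X = A ∩ B
        Y = A ∪ B

        u∈X : u ∈ X
        u∈X = x∈p∩q⁺ (u∈Side U u∉U , u∈Side W u∉W)

        isCut : IsCut G (∂ X)
        -- A vertex outside `N[ A ]` is also outside the smaller `N[ X ]`.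
        isCut = ∂-isCut u∈X (proj₂ (cut⇒∃∉N-Side U u∉U isCutU) ∘ N-mono (p∩q⊆p A B))

        -- Ensures that the truncated `n ∸ κ` is a true difference.
        κ≤n : κ ≤ n
        κ≤n = subst (_≤ n) ∣U∣≡κ (∣p∣≤n U)

        ∣∂A∣≡κ : ∣ ∂ A ∣ ≡ κ
        ∣∂A∣≡κ = trans (cong ∣_∣ (∂-Side≡ cutU u∉U)) ∣U∣≡κ
        ∣∂B∣≡κ : ∣ ∂ B ∣ ≡ κ
        ∣∂B∣≡κ = trans (cong ∣_∣ (∂-Side≡ cutW u∉W)) ∣W∣≡κ

        open ≤-Reasoning

        κ≮∣∂X∣ : ¬ κ < ∣ ∂ X ∣
        κ≮∣∂X∣ κ<∣∂X∣ = <-irrefl refl (begin-strict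
          -- The 1 counts `u ∈ X`. It exactly offsets the possible rounding up in
          -- `h + h ≤ suc (n ∸ κ)`, so the strictness of `κ < ∣ ∂ X ∣` gives the contradiction.
          n + (1 + κ)                          <⟨ +-mono-≤-< n≤∣NY∣ (+-mono-≤-< (x∈p⇒0<∣p∣ u∈X) κ<∣∂X∣) ⟩
          ∣ N[ Y ] ∣ + (∣ X ∣ + ∣ ∂ X ∣)       ≡⟨ cong (∣ N[ Y ] ∣ +_) ∣N[ X ]∣ ⟨
          ∣ N[ Y ] ∣ + ∣ N[ X ] ∣              ≤⟨ ∣N∣-submodular A B ⟩
          ∣ N[ A ] ∣ + ∣ N[ B ] ∣              ≤⟨ +-mono-≤ (∣N∣≤ A≤t ∣∂A∣≡κ) (∣N∣≤ B≤t ∣∂B∣≡κ) ⟩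
          h + κ + (h + κ)                      ≡⟨ regroup h κ ⟩
          h + h + κ + κ                        ≤⟨ +-monoˡ-≤ κ (+-monoˡ-≤ κ (⌈n/2⌉+⌈n/2⌉≤1+n (n ∸ κ))) ⟩
          suc (n ∸ κ) + κ + κ                  ≡⟨ cong (λ m → suc m + κ) (m∸n+n≡m κ≤n) ⟩
          suc n + κ                            ≡⟨ +-suc n κ ⟨
          n + (1 + κ)                          ∎)
          where
          h : ℕ
          h = ⌈ n ∸ κ /2⌉

          regroup : ∀ a b → a + b + (a + b) ≡ a + a + b + b
          regroup = solve-∀

          ∣N∣≤ : ∀ {Z} → ∣ Z ∣ ≤ t → ∣ ∂ Z ∣ ≡ κ → ∣ N[ Z ] ∣ ≤ h + κ
          ∣N∣≤ {Z} Z≤t ∣∂Z∣≡κ = begin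
            ∣ N[ Z ] ∣     ≡⟨ ∣N[ Z ]∣ ⟩
            ∣ Z ∣ + ∣ ∂ Z ∣ ≤⟨ +-mono-≤ (≤-trans Z≤t t≤) (≤-reflexive ∣∂Z∣≡κ) ⟩
            h + κ          ∎

          ∣∂Y∣<κ : ∣ ∂ Y ∣ < κ
          ∣∂Y∣<κ = +-cancelʳ-< κ _ _ (begin-strict
            ∣ ∂ Y ∣ + κ        <⟨ +-monoʳ-< ∣ ∂ Y ∣ κ<∣∂X∣ ⟩
            ∣ ∂ Y ∣ + ∣ ∂ X ∣  ≤⟨ ∣∂∣-submodular A B ⟩
            ∣ ∂ A ∣ + ∣ ∂ B ∣  ≤⟨ +-mono-≤ (≤-reflexive ∣∂A∣≡κ) (≤-reflexive ∣∂B∣≡κ) ⟩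
            κ + κ              ∎)

          n≤∣NY∣ : n ≤ ∣ N[ Y ] ∣
          n≤∣NY∣ = subst (_≤ ∣ N[ Y ] ∣) (∣⊤∣≡n n) (p⊆q⇒∣p∣≤∣q∣ {p = ⊤} λ {v} _ →
            -- A vertex outside `N[ Y ]` would make `∂ Y` a cut with fewer than `κ` vertices.
            decidable-stable (v ∈? N[ Y ]) λ v∉NY →
              <⇒≱ ∣∂Y∣<κ (κ-min _ (∂-isCut (p⊆p∪q B (u∈Side U u∉U)) v∉NY)))

      Least : Subset n → Set
      Least S = ∀ U → IsCutOfSize G κ U → u ∉ U → ∣ Side G U u ∣ ≤ t → Side G S u ⊆ Side G U u

      -- Descent on the size of the side at `u`: as long as some admissible `W` violates leastness
      -- of `U`, uncrossing `U` with `W` gives an admissible cut with a strictly smaller side.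
      ∃-least : ∃ Admissible → ∃ λ S → Admissible S × Least S
      ∃-least (U₀ , U₀-adm) = <-rec P step _ U₀ U₀-adm refl
        where
        P : ℕ → Set
        P m = ∀ U → Admissible U → ∣ Side G U u ∣ ≡ m → ∃ λ S → Admissible S × Least S

        step : ∀ m → (∀ {k} → k < m → P k) → P m
        step _ rec U U-adm refl
          with anySubset? (λ W → admissible? W ×-dec ¬? (Side G U u ⊆? Side G W u))
        ... | no ∄W = U , U-adm , λ W cut u∉W W≤t → decidable-stable (Side G U u ⊆? Side G W u)
                        λ U⊈W → ∄W (W , (cut , u∉W , W≤t) , U⊈W)
        ... | yes (W , W-adm , U⊈W) = rec smaller (∂ X) (∂-∩-admissible U-adm W-adm) refl
          where
          A B X : Subset n
          A = Side G U u
          B = Side G W u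
          X = A ∩ B
          S⊆X : Side G (∂ X) u ⊆ X
          S⊆X = Side-∂ (x∈p∩q⁺ (u∈Side U (proj₁ (proj₂ U-adm)) , u∈Side W (proj₁ (proj₂ W-adm))))
          smaller : ∣ Side G (∂ X) u ∣ < ∣ A ∣
          -- Without a decrease, the new side would be all of `A`, whence `A ⊆ X ⊆ B`, against the
          -- choice of `W`.
          smaller = ≰⇒> λ A≤S → U⊈W λ {x} x∈A → p∩q⊆q A B (S⊆X
            (subst (x ∈_) (sym (p⊆q∧∣q∣≤∣p∣⇒p≡q (p∩q⊆p A B ∘ S⊆X) A≤S)) x∈A))

theorem6 : ∀ {n : ℕ} (G : Graph n) (κ : ℕ) →
    Connected G → ¬ Complete G → IsVertexConnectivity G κ → 4 * κ < n →
    (u : Fin n) (t : ℕ) → 0 < t → t ≤ ⌈ n ∸ κ /2⌉ →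
    ∃ (λ (U : Subset n) → IsCutOfSize G κ U × u ∉ U × ∣ Side G U u ∣ ≤ t) →
    ∃! _≡_ (λ (S : Subset n) →
    IsCutOfSize G κ S × u ∉ S × ∣ Side G S u ∣ ≤ t ×
    (∀ (U : Subset n) → IsCutOfSize G κ U → u ∉ U → ∣ Side G U u ∣ ≤ t →
    Side G S u ⊆ Side G U u))
theorem6 G κ _ _ (_ , κ-min) _ u t _ t≤ ∃U
  with ∃-least G κ-min u t≤ ∃U
... | S , (S-cut , u∉S , S≤t) , S-least = S , (S-cut , u∉S , S≤t , S-least) , unique
  where
  unique : ∀ {T} → _ → S ≡ T
  -- Leastness in both directions makes the two sides at `u` equal, and each cut is the boundary of
  -- its side.
  unique {T} (T-cut , u∉T , T≤t , T-least) =
    trans (sym (∂-Side≡ G κ-min u S-cut u∉S))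
      (trans (cong (∂ G) (⊆-antisym (S-least T T-cut u∉T T≤t) (T-least S S-cut u∉S S≤t)))
        (∂-Side≡ G κ-min u T-cut u∉T))
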